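{- Let $r,m\in\mathbb{N}$, let $E\subset\mathbb{R}^r$ be a compact domain and let $f:E\to\mathbb{R}^m$ be a solvable function. Then there exists a countable ordinal $\alpha<\omega_1$ such that $E_\alpha=\emptyset$, where $\{E_\gamma\}_\gamma$ is the sequence of $f$-removed sets on $E$.
   Context: A compact domain is a nonempty connected compact subset of $\mathbb{R}^r$; $\omega_1$ is the first uncountable ordinal. For $S\subseteq\mathbb{R}^r$ and $g:S\to\mathbb{R}^m$, $D_g$ is the set of points of $S$ at which $g$ is discontinuous with respect to the subspace topology of $S$. The sequence of $f$-removed sets on $E$: $E_0=E$; $E_{\alpha+1}=D_{f\restriction_{E_\alpha}}$; $E_\lambda=\bigcap_{\beta<\lambda}E_\beta$ for limit $\lambda$. A function $f:E\to\mathbb{R}^m$ is solvable if it is of class Baire one (a pointwise limit on $E$ of a sequence of continuous functions $E\to\mathbb{R}^m$) and for every closed set $K\subseteq E$ the set $D_{f\restriction_K}$ is closed. -}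

module Defs where

open import Data.List.Base using (List)
open import Data.List.Relation.Unary.Any using (Any)
open import Data.Nat.Base as ℕ using (ℕ)
open import Data.Product.Base using (Σ; _×_; ∃; ∃-syntax; _,_; proj₁; proj₂)
open import Data.Rational.Base using (ℚ; _<_)
open import Data.Sum.Base using (_⊎_)
open import Data.Vec.Functional using (Vector)
open import Function.Bundles using (_⇔_; _↣_)
open import Induction.WellFounded using (Acc; acc; WellFounded)
open import Level using (0ℓ; Level) renaming (suc to lsuc)
open import Relation.Binary.Core using (Rel)
open import Relation.Binary.PropositionalEquality.Core using (_≡_)
open import Relation.Binary.Structures using (IsStrictTotalOrder)
open import Relation.Nullary.Negation.Core using (¬_)
open import Relation.Unary
  using (Pred; _∈_; _∉_; _⊆_; _∩_; _∪_; Satisfiable; Empty; U)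

------------------------------------------------------------------------
-- Real numbers

-- Two-sided Dedekind cuts: q ∈ lower means "q < x", q ∈ upper means
-- "x < q".
record ℝ : Set₁ where
  field
    lower upper     : Pred ℚ 0ℓ
    lower-inhabited : Satisfiable lower
    upper-inhabited : Satisfiable upper
    lower-rounded   : ∀ p → p ∈ lower ⇔ (∃[ q ] (p < q × q ∈ lower))
    upper-rounded   : ∀ q → q ∈ upper ⇔ (∃[ p ] (p < q × p ∈ upper))
    disjoint        : Empty (lower ∩ upper)
    located         : ∀ {p q} → p < q → p ∈ lower ⊎ q ∈ upper

open ℝ public

-- Two cuts denote the same real when they have the same lower and upper
-- sets.  No separate equality on ℝ is introduced: everything below sees
-- a real only through the rational intervals containing it, so open sets,
-- closed sets and continuous functions (hence also pointwise limits of
-- continuous functions) respect that equality automatically.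
ℝ^_ : ℕ → Set₁
ℝ^ r = Vector ℝ r

infix 9 ℝ^_

Subset : ℕ → Set₂
Subset r = Pred (ℝ^ r) (lsuc 0ℓ)

------------------------------------------------------------------------
-- The Euclidean topology of ℝ^r, generated by the open boxes
-- ∏ᵢ (aᵢ , bᵢ) with rational endpoints

Box : ℕ → Set
Box r = Vector (ℚ × ℚ) r

infix 4 _∈ᵇ_

_∈ᵇ_ : ∀ {r} → ℝ^ r → Box r → Set
x ∈ᵇ B = ∀ i → proj₁ (B i) ∈ lower (x i) × proj₂ (B i) ∈ upper (x i)

IsOpen : ∀ {r} → Subset r → Set₁
IsOpen O = ∀ x → x ∈ O → ∃[ B ] (x ∈ᵇ B × (∀ y → y ∈ᵇ B → y ∈ O))

IsCompact : ∀ {r} → Subset r → Set₂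
IsCompact {r} E =
  (I : Set₁) (O : I → Subset r) → (∀ i → IsOpen (O i)) →
  (∀ x → x ∈ E → ∃[ i ] x ∈ O i) →
  ∃[ is ] (∀ x → x ∈ E → Any (λ i → x ∈ O i) is)

IsConnected : ∀ {r} → Subset r → Set₂
IsConnected {r} E =
  (O P : Subset r) → IsOpen O → IsOpen P → E ⊆ O ∪ P →
  Satisfiable (E ∩ O) → Satisfiable (E ∩ P) → ¬ Empty (E ∩ (O ∩ P))

record IsCompactDomain {r : ℕ} (E : Subset r) : Set₂ where
  field
    nonempty  : Satisfiable E
    connected : IsConnected E
    compact   : IsCompact E

------------------------------------------------------------------------
-- Functions E → ℝ^m.  The type of points of E is ∃ E, and the subsets
-- of E are the predicates on ∃ E.

-- Closed in the subspace topology of E, which for compact E is the same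
-- as being a closed subset of ℝ^r contained in E.
IsClosed : ∀ {r} {E : Subset r} → Pred (∃ E) (lsuc 0ℓ) → Set₁
IsClosed K =
  ∀ x → x ∉ K → ∃[ B ] (proj₁ x ∈ᵇ B × (∀ y → proj₁ y ∈ᵇ B → y ∉ K))

module _ {r m : ℕ} {E : Subset r} where

  -- Continuity at x of the restriction of g to K, for the subspace
  -- topology of K; it is meant for points x of K.
  ContinuousAt : ∀ {ℓ} → (∃ E → ℝ^ m) → Pred (∃ E) ℓ → ∃ E → Set _
  ContinuousAt g K x =
    ∀ V → g x ∈ᵇ V →
    ∃[ B ] (proj₁ x ∈ᵇ B × (∀ y → y ∈ K → proj₁ y ∈ᵇ B → g y ∈ᵇ V))

  -- D g K is the set of discontinuity points of g↾K.
  D : (∃ E → ℝ^ m) → Pred (∃ E) (lsuc 0ℓ) → Pred (∃ E) (lsuc 0ℓ)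
  D g K x = x ∈ K × ¬ ContinuousAt g K x

  Continuous : (∃ E → ℝ^ m) → Set₁
  Continuous g = ∀ x → ContinuousAt g U x

  ConvergesPointwise : (ℕ → ∃ E → ℝ^ m) → (∃ E → ℝ^ m) → Set₁
  ConvergesPointwise fs f =
    ∀ x V → f x ∈ᵇ V → ∃[ N ] (∀ n → N ℕ.≤ n → fs n x ∈ᵇ V)

  BaireOne : (∃ E → ℝ^ m) → Set₁
  BaireOne f = ∃[ fs ] ((∀ n → Continuous (fs n)) × ConvergesPointwise fs f)

  record Solvable (f : ∃ E → ℝ^ m) : Set₂ where
    field
      baireOne : BaireOne f
      closed-D : (K : Pred (∃ E) (lsuc 0ℓ)) → IsClosed K → IsClosed (D f K)

------------------------------------------------------------------------
-- Countable ordinals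

-- An element α of a countable well-order stands for the order type of
-- { β ∣ β < α }.  The ordinals so represented are exactly those below ω₁:
-- a countable ordinal α is represented by the top element of α + 1.
record CountableWellOrder : Set₁ where
  infix 4 _≺_
  field
    Carrier            : Set
    _≺_                : Rel Carrier 0ℓ
    isStrictTotalOrder : IsStrictTotalOrder _≡_ _≺_
    wellFounded        : WellFounded _≺_
    countable          : Carrier ↣ ℕ

  IsZero : Pred Carrier 0ℓ
  IsZero α = ∀ β → ¬ β ≺ α

  -- α ⋖ β : β is the successor α + 1.
  infix 4 _⋖_
  _⋖_ : Rel Carrier 0ℓ
  α ⋖ β = α ≺ β × (∀ γ → α ≺ γ → ¬ γ ≺ β)

  IsLimit : Pred Carrier 0ℓ
  IsLimit α = ¬ IsZero α × (∀ β → ¬ β ⋖ α)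

------------------------------------------------------------------------
-- The sequence of f-removed sets on E

module _ {r m : ℕ} {E : Subset r} (f : ∃ E → ℝ^ m)
         (W : CountableWellOrder) where
  open CountableWellOrder W

  -- Recursion on accessibility.  Every α is exactly one of zero, a
  -- successor or a limit, so exactly one summand applies: it says
  -- respectively that x ∈ E (which holds by typing), that x ∈ D f E_β
  -- where α = β + 1, and that x ∈ E_β for every β ≺ α.
  removedAcc : ∀ α → Acc _≺_ α → Pred (∃ E) (lsuc 0ℓ)
  removedAcc α (acc rs) x =
      IsZero α
    ⊎ (∃[ β ] Σ (β ⋖ α) λ β⋖α → x ∈ D f (removedAcc β (rs (proj₁ β⋖α))))
    ⊎ (IsLimit α × (∀ β (β≺α : β ≺ α) → x ∈ removedAcc β (rs β≺α)))

  removed : Carrier → Pred (∃ E) (lsuc 0ℓ)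
  removed α = removedAcc α (wellFounded α)

{-# OPTIONS --safe #-}
-- Call a rational box missed at (W , α) if it is disjoint from D f (E_α), with α
-- read in the countable well-order W.  For each missed box choose such a well-order,
-- and let τ be the top element added to the sum of all of them.  Comparing along the
-- inclusion of each summand, E_τ is disjoint from every missed box.  If E_τ were
-- nonempty, f restricted to the closed set E_τ would, being Baire one, be continuous at
-- some x ∈ E_τ.  As D f (E_τ) is closed, some box around x is then missed at τ, so x
-- cannot lie in E_τ.
module Submission where

open import Defs
open import Axiom.ExcludedMiddle using (ExcludedMiddle)
open import Data.Nat.Base using (ℕ)
open import Data.Product.Base using (∃; ∃-syntax)
open import Relation.Unary using (Empty)

open import Data.Empty using (⊥-elim)
import Data.Fin.Properties as Fin
open import Data.Integer.Base using (ℤ; +_; -[1+_])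
open import Data.List.Base using (map)
open import Data.List.Extrema.Nat using (max; xs≤max)
import Data.List.Relation.Unary.All as All
import Data.List.Relation.Unary.Any.Properties as Any
open import Data.Nat.Base as ℕ using (zero; suc; _+_; _*_; _⊔_)
import Data.Nat.Induction as ℕ
import Data.Nat.Properties as ℕ
open import Data.Product.Base using (Σ; _×_; _,_; proj₁; proj₂; curry)
open import Data.Rational.Base as ℚ using (ℚ; mkℚ)
import Data.Rational.Properties as ℚ
open import Data.Sum.Base using (_⊎_; inj₁; inj₂; [_,_]′)
open import Data.Vec.Base using (Vec; []; _∷_; lookup; tabulate)
open import Data.Vec.Properties using (lookup∘tabulate)
open import Function.Base using (_∘_; id)
open import Function.Bundles using (_↣_; mk↣; Injection; Equivalence)
open import Induction.WellFounded using (Acc; acc; WellFounded)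
open import Level using (0ℓ; Lift; lift) renaming (suc to lsuc)
open import Relation.Binary.Construct.Add.Supremum.Strict
  using (_<⁺_; <⁺-isStrictTotalOrder-≡; [_]; [_]<⊤⁺)
open import Relation.Binary.Core using (Rel)
open import Relation.Binary.Definitions
  using (Trichotomous; Transitive; tri<; tri≈; tri>)
open import Relation.Binary.PropositionalEquality
  using (_≡_; refl; sym; cong; subst; isEquivalence)
open import Relation.Binary.Structures using (IsStrictTotalOrder)
open import Relation.Binary.Structures.Biased using (isStrictTotalOrderᶜ)
open import Relation.Nullary.Construct.Add.Supremum using (_⁺; ⊤⁺; [_])
open import Relation.Nullary.Decidable using (yes; no; decidable-stable)
open import Relation.Nullary.Negation using (¬_; contradiction)
open import Relation.Unary using (Pred; _∈_; _∉_; _⊆_; Satisfiable)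

-- Countability

-- An injective pairing: with `s = a + b` the code lies between `s * s` and `s * s + s`, below the
-- next square, so it determines `s` and then `a`.
squareCode : ℕ → ℕ → ℕ
squareCode a b = (a + b) * (a + b) + a

squareCode-sum-≮ : ∀ a b c d → squareCode a b ≡ squareCode c d → ¬ a + b ℕ.< c + d
squareCode-sum-≮ a b c d eq s<t = ℕ.<-irrefl eq (begin-strict
  s * s + a       ≤⟨ ℕ.+-monoʳ-≤ (s * s) (ℕ.m≤m+n a b) ⟩
  s * s + s       ≡⟨ ℕ.+-comm (s * s) s ⟩
  s + s * s       ≡⟨ ℕ.*-suc s s ⟨
  s * suc s       <⟨ ℕ.m<n+m (s * suc s) ℕ.z<s ⟩
  suc s * suc s   ≤⟨ ℕ.*-mono-≤ s<t s<t ⟩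
  t * t           ≤⟨ ℕ.m≤m+n (t * t) c ⟩
  t * t + c       ∎)
  where
  open ℕ.≤-Reasoning
  s = a + b
  t = c + d

squareCode-injective : ∀ {a b c d} → squareCode a b ≡ squareCode c d → a ≡ c × b ≡ d
squareCode-injective {a} {b} {c} {d} eq = a≡c , b≡d
  where
  sums : a + b ≡ c + d
  sums with ℕ.<-cmp (a + b) (c + d)
  ... | tri< lt _ _ = contradiction lt (squareCode-sum-≮ a b c d eq)
  ... | tri≈ _ e _  = e
  ... | tri> _ _ gt = contradiction gt (squareCode-sum-≮ c d a b (sym eq))
  a≡c : a ≡ c
  a≡c = ℕ.+-cancelˡ-≡ ((c + d) * (c + d)) a c (subst (λ s → s * s + a ≡ squareCode c d) sums eq)
  b≡d : b ≡ d
  b≡d = ℕ.+-cancelˡ-≡ c b d (subst (λ z → z + b ≡ c + d) a≡c sums)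

Σ-countable : {A : Set} {B : A → Set} → A ↣ ℕ → (∀ a → B a ↣ ℕ) → Σ A B ↣ ℕ
Σ-countable {A} {B} ca cb = mk↣ {to = code} injective
  where
  open Injection using (to)
  code : Σ A B → ℕ
  code (a , b) = squareCode (to ca a) (to (cb a) b)
  injective : ∀ {x y} → code x ≡ code y → x ≡ y
  injective {a , b} {a′ , b′} eq with squareCode-injective {to ca a} {to (cb a) b} eq
  ... | ea , eb with Injection.injective ca ea
  ... | refl = cong (a ,_) (Injection.injective (cb a) eb)

ℕ-countable : ℕ ↣ ℕ
ℕ-countable = mk↣ id

×-countable : {A B : Set} → A ↣ ℕ → B ↣ ℕ → (A × B) ↣ ℕ
×-countable ca cb = Σ-countable ca (λ _ → cb)

⁺-countable : {A : Set} → A ↣ ℕ → (A ⁺) ↣ ℕ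
⁺-countable {A} c = mk↣ {to = code} injective
  where
  code : A ⁺ → ℕ
  code ⊤⁺    = 0
  code [ a ] = suc (Injection.to c a)
  injective : ∀ {x y} → code x ≡ code y → x ≡ y
  injective {⊤⁺}    {⊤⁺}    _  = refl
  injective {[ _ ]} {[ _ ]} eq = cong [_] (Injection.injective c (ℕ.suc-injective eq))

ℤ-countable : ℤ ↣ ℕ
ℤ-countable = mk↣ {to = code} injective
  where
  code : ℤ → ℕ
  code (+ n)    = squareCode 0 n
  code -[1+ n ] = squareCode 1 n
  injective : ∀ {x y} → code x ≡ code y → x ≡ y
  injective {+ m}      {+ n}      eq = cong +_ (proj₂ (squareCode-injective {0} {m} {0} {n} eq))
  injective {+ m}      { -[1+ n ]} eq with () ← proj₁ (squareCode-injective {0} {m} {1} {n} eq)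
  injective { -[1+ m ]} {+ n}      eq with () ← proj₁ (squareCode-injective {1} {m} {0} {n} eq)
  injective { -[1+ m ]} { -[1+ n ]} eq = cong -[1+_] (proj₂ (squareCode-injective {1} {m} {1} {n} eq))

ℚ-countable : ℚ ↣ ℕ
ℚ-countable = mk↣ {to = code} injective
  where
  pairs : (ℤ × ℕ) ↣ ℕ
  pairs = ×-countable ℤ-countable ℕ-countable
  code : ℚ → ℕ
  code (mkℚ n d _) = Injection.to pairs (n , d)
  injective : ∀ {x y} → code x ≡ code y → x ≡ y
  injective {mkℚ n d _} {mkℚ n′ d′ _} eq
    with refl ← Injection.injective pairs {n , d} {n′ , d′} eq = refl

Vec-countable : {A : Set} → A ↣ ℕ → ∀ n → Vec A n ↣ ℕ
Vec-countable c zero = mk↣ {to = λ _ → 0} λ { {[]} {[]} _ → refl }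
Vec-countable {A} c (suc n) = mk↣ {to = code} injective
  where
  cells : (A × Vec A n) ↣ ℕ
  cells = ×-countable c (Vec-countable c n)
  code : Vec A (suc n) → ℕ
  code (a ∷ v) = Injection.to cells (a , v)
  injective : ∀ {x y} → code x ≡ code y → x ≡ y
  injective {a ∷ v} {b ∷ w} eq with refl ← Injection.injective cells {a , v} {b , w} eq = refl

-- Vectors, because a code has to be injective up to `≡`, and pointwise equal functions in `Box n`
-- need not be provably `≡`.
RationalBox : ℕ → Set
RationalBox n = Vec (ℚ × ℚ) n

RationalBox-countable : ∀ n → RationalBox n ↣ ℕ
RationalBox-countable = Vec-countable (×-countable ℚ-countable ℚ-countable)

∈ᵇ-tabulate : ∀ {n} (B : Box n) (x : ℝ^ n) → x ∈ᵇ B → x ∈ᵇ lookup (tabulate B)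
∈ᵇ-tabulate B x x∈B i rewrite lookup∘tabulate B i = x∈B i

∈ᵇ-tabulate⁻ : ∀ {n} (B : Box n) (x : ℝ^ n) → x ∈ᵇ lookup (tabulate B) → x ∈ᵇ B
∈ᵇ-tabulate⁻ B x x∈B i with p ← x∈B i rewrite lookup∘tabulate B i = p

ℕ-wellOrder : CountableWellOrder
ℕ-wellOrder = record
  { Carrier            = ℕ
  ; _≺_                = ℕ._<_
  ; isStrictTotalOrder = ℕ.<-isStrictTotalOrder
  ; wellFounded        = ℕ.<-wellFounded
  ; countable          = ℕ-countable
  }

-- Ordinal sum of a sequence of countable well-orders, with a top element

module OrdinalSum (Ws : ℕ → CountableWellOrder) where
  private
    module Ws n = CountableWellOrder (Ws n)

  data _<ₗ_ : Rel (Σ ℕ Ws.Carrier) 0ℓ where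
    left  : ∀ {m n a b} → m ℕ.< n → (m , a) <ₗ (n , b)
    right : ∀ {n a b} → Ws._≺_ n a b → (n , a) <ₗ (n , b)

  mutual
    -- Lexicographic induction, on the index outside and on the element inside: a step to an earlier
    -- summand restarts the inner induction from the well-foundedness of that summand.
    <ₗ-accessible : ∀ {n a} → Acc ℕ._<_ n → Acc (Ws._≺_ n) a → Acc _<ₗ_ (n , a)
    <ₗ-accessible accₙ accₐ = acc (<ₗ-below accₙ accₐ)

    <ₗ-below : ∀ {n a} → Acc ℕ._<_ n → Acc (Ws._≺_ n) a →
               ∀ {k} → k <ₗ (n , a) → Acc _<ₗ_ k
    <ₗ-below (acc rs) _        (left {m} {a = a} m<n) =
      <ₗ-accessible (rs m<n) (Ws.wellFounded m a)
    <ₗ-below accₙ     (acc ss) (right a≺b)            = <ₗ-accessible accₙ (ss a≺b)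

  <ₗ-wellFounded : WellFounded _<ₗ_
  <ₗ-wellFounded (n , a) = <ₗ-accessible (ℕ.<-wellFounded n) (Ws.wellFounded n a)

  <ₗ-trans : Transitive _<ₗ_
  <ₗ-trans (left p)  (left q)  = left (ℕ.<-trans p q)
  <ₗ-trans (left p)  (right q) = left p
  <ₗ-trans (right p) (left q)  = left q
  <ₗ-trans (right {n} p) (right q) =
    right (IsStrictTotalOrder.trans (Ws.isStrictTotalOrder n) p q)

  left⁻ : ∀ {n a b} → (n , a) <ₗ (n , b) → Ws._≺_ n a b
  left⁻ (left n<n) = contradiction n<n (ℕ.<-irrefl refl)
  left⁻ (right p)  = p

  <ₗ⇒≤ : ∀ {m n a b} → (m , a) <ₗ (n , b) → m ℕ.≤ n
  <ₗ⇒≤ (left m<n) = ℕ.<⇒≤ m<n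
  <ₗ⇒≤ (right _)  = ℕ.≤-refl

  <ₗ-cmp : Trichotomous _≡_ _<ₗ_
  <ₗ-cmp (m , a) (n , b) with ℕ.<-cmp m n
  ... | tri< lt ne _ =
    tri< (left lt) (ne ∘ cong proj₁) (λ p → ℕ.<⇒≱ lt (<ₗ⇒≤ p))
  ... | tri> _ ne gt =
    tri> (λ p → ℕ.<⇒≱ gt (<ₗ⇒≤ p)) (ne ∘ cong proj₁) (left gt)
  ... | tri≈ _ refl _ with IsStrictTotalOrder.compare (Ws.isStrictTotalOrder m) a b
  ... | tri< lt ne ng = tri< (right lt) (λ { refl → ne refl }) (ng ∘ left⁻)
  ... | tri≈ nl refl ng = tri≈ (nl ∘ left⁻) refl (ng ∘ left⁻)
  ... | tri> nl ne gt = tri> (nl ∘ left⁻) (λ { refl → ne refl }) (right gt)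

  _<ₛ_ : Rel (Σ ℕ Ws.Carrier ⁺) 0ℓ
  _<ₛ_ = _<⁺_ _<ₗ_

  <ₛ-wellFounded : WellFounded _<ₛ_
  <ₛ-wellFounded = λ where
      ⊤⁺    → acc λ { [ k ]<⊤⁺ → below (<ₗ-wellFounded k) }
      [ k ] → below (<ₗ-wellFounded k)
    where
    below : ∀ {k} → Acc _<ₗ_ k → Acc _<ₛ_ [ k ]
    below (acc rs) = acc λ { [ p ] → below (rs p) }

  sum⁺ : CountableWellOrder
  sum⁺ = record
    { Carrier            = Σ ℕ Ws.Carrier ⁺
    ; _≺_                = _<ₛ_
    ; isStrictTotalOrder = <⁺-isStrictTotalOrder-≡ _ (isStrictTotalOrderᶜ record
        { isEquivalence = isEquivalence ; trans = <ₗ-trans ; compare = <ₗ-cmp })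
    ; wellFounded        = <ₛ-wellFounded
    ; countable          = ⁺-countable (Σ-countable ℕ-countable Ws.countable)
    }

-- Rational boxes

infix 4 _⋐_

-- Endpoint condition placing the closed box of `C` inside the open box `B`.
_⋐_ : ∀ {n} → Box n → Box n → Set
C ⋐ B = ∀ i → proj₁ (B i) ℚ.< proj₁ (C i) × proj₂ (C i) ℚ.< proj₂ (B i)

-- Complement of the closed box, phrased positively so that openness can be read off.
Exterior : ∀ {n} → Box n → ℝ^ n → Set
Exterior B x = ∃[ i ] (proj₁ (B i) ∈ upper (x i) ⊎ proj₂ (B i) ∈ lower (x i))

∈ᵇ⇒∉Exterior : ∀ {n} (B : Box n) x → x ∈ᵇ B → ¬ Exterior B x
∈ᵇ⇒∉Exterior B x x∈B (i , inj₁ x<a) = disjoint (x i) _ (proj₁ (x∈B i) , x<a)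
∈ᵇ⇒∉Exterior B x x∈B (i , inj₂ b<x) = disjoint (x i) _ (b<x , proj₂ (x∈B i))

-- Corresponding endpoints of `B` and `C` are strictly apart, so locatedness puts each coordinate
-- either inside the endpoint of `B` or beyond that of `C`.
∉Exterior⇒∈ᵇ : ∀ {n} {B C : Box n} x → C ⋐ B → ¬ Exterior C x → x ∈ᵇ B
∉Exterior⇒∈ᵇ x C⋐B ¬ext i =
    [ id , (λ x<a → ⊥-elim (¬ext (i , inj₁ x<a))) ]′ (located (x i) (proj₁ (C⋐B i)))
  , [ (λ b<x → ⊥-elim (¬ext (i , inj₂ b<x))) , id ]′ (located (x i) (proj₂ (C⋐B i)))

⋐⇒⊆ : ∀ {n} {B C : Box n} x → C ⋐ B → x ∈ᵇ C → x ∈ᵇ B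
⋐⇒⊆ {C = C} x C⋐B x∈C = ∉Exterior⇒∈ᵇ x C⋐B (∈ᵇ⇒∉Exterior C x x∈C)

box-around : ∀ {n} (x : ℝ^ n) → ∃[ B ] x ∈ᵇ B
box-around x =
    (λ i → proj₁ (lower-inhabited (x i)) , proj₁ (upper-inhabited (x i)))
  , (λ i → proj₂ (lower-inhabited (x i)) , proj₂ (upper-inhabited (x i)))

lower-open : ∀ {n} (x : ℝ^ n) i {q} → q ∈ lower (x i) →
             ∃[ B ] (x ∈ᵇ B × (∀ y → y ∈ᵇ B → q ∈ lower (y i)))
lower-open {n} x i {q} q<x = proj₁ ∘ cell , proj₂ ∘ cell , inside
  where
  -- Only side `i` is constrained, with `q` itself as left endpoint; the other sides are arbitrary.
  cell : ∀ j → Σ (ℚ × ℚ) λ c → proj₁ c ∈ lower (x j) × proj₂ c ∈ upper (x j)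
  cell j with i Fin.≟ j
  ... | yes refl = (q , _) , q<x , proj₂ (upper-inhabited (x i))
  ... | no _     = (_ , _) , proj₂ (box-around x) j
  inside : ∀ y → y ∈ᵇ (proj₁ ∘ cell) → q ∈ lower (y i)
  inside y y∈B with y∈Bᵢ ← y∈B i with i Fin.≟ i
  ... | yes refl = proj₁ y∈Bᵢ
  ... | no i≢i   = contradiction refl i≢i

upper-open : ∀ {n} (x : ℝ^ n) i {q} → q ∈ upper (x i) →
             ∃[ B ] (x ∈ᵇ B × (∀ y → y ∈ᵇ B → q ∈ upper (y i)))
upper-open {n} x i {q} x<q = proj₁ ∘ cell , proj₂ ∘ cell , inside
  where
  cell : ∀ j → Σ (ℚ × ℚ) λ c → proj₁ c ∈ lower (x j) × proj₂ c ∈ upper (x j)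
  cell j with i Fin.≟ j
  ... | yes refl = (_ , q) , proj₂ (lower-inhabited (x i)) , x<q
  ... | no _     = (_ , _) , proj₂ (box-around x) j
  inside : ∀ y → y ∈ᵇ (proj₁ ∘ cell) → q ∈ upper (y i)
  inside y y∈B with y∈Bᵢ ← y∈B i with i Fin.≟ i
  ... | yes refl = proj₂ y∈Bᵢ
  ... | no i≢i   = contradiction refl i≢i

Exterior-open : ∀ {n} (B : Box n) x → Exterior B x →
                ∃[ C ] (x ∈ᵇ C × (∀ y → y ∈ᵇ C → Exterior B y))
Exterior-open B x (i , inj₁ x<a) with C , x∈C , C⊆ ← upper-open x i x<a =
  C , x∈C , λ y y∈C → i , inj₁ (C⊆ y y∈C)
Exterior-open B x (i , inj₂ b<x) with C , x∈C , C⊆ ← lower-open x i b<x =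
  C , x∈C , λ y y∈C → i , inj₂ (C⊆ y y∈C)

module _ (x : ℝ) where

  lower-⊔ : ∀ {p q} → p ∈ lower x → q ∈ lower x → p ℚ.⊔ q ∈ lower x
  lower-⊔ {p} {q} p<x q<x with ℚ.⊔-sel p q
  ... | inj₁ eq = subst (lower x) (sym eq) p<x
  ... | inj₂ eq = subst (lower x) (sym eq) q<x

  upper-⊓ : ∀ {p q} → p ∈ upper x → q ∈ upper x → p ℚ.⊓ q ∈ upper x
  upper-⊓ {p} {q} x<p x<q with ℚ.⊓-sel p q
  ... | inj₁ eq = subst (upper x) (sym eq) x<p
  ... | inj₂ eq = subst (upper x) (sym eq) x<q

  lower-above-two : ∀ {p q} → p ∈ lower x → q ∈ lower x →
                    ∃[ s ] (s ∈ lower x × p ℚ.< s × q ℚ.< s)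
  lower-above-two p<x q<x
    with p′ , p<p′ , p′<x ← Equivalence.to (lower-rounded x _) p<x
       | q′ , q<q′ , q′<x ← Equivalence.to (lower-rounded x _) q<x =
    p′ ℚ.⊔ q′ , lower-⊔ p′<x q′<x ,
    ℚ.<-≤-trans p<p′ (ℚ.p≤p⊔q p′ q′) , ℚ.<-≤-trans q<q′ (ℚ.p≤q⊔p p′ q′)

  upper-below-two : ∀ {p q} → p ∈ upper x → q ∈ upper x →
                    ∃[ s ] (s ∈ upper x × s ℚ.< p × s ℚ.< q)
  upper-below-two x<p x<q
    with p′ , p′<p , x<p′ ← Equivalence.to (upper-rounded x _) x<p
       | q′ , q′<q , x<q′ ← Equivalence.to (upper-rounded x _) x<q =
    p′ ℚ.⊓ q′ , upper-⊓ x<p′ x<q′ ,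
    ℚ.≤-<-trans (ℚ.p⊓q≤p p′ q′) p′<p , ℚ.≤-<-trans (ℚ.p⊓q≤q p′ q′) q′<q

-- Roundedness leaves a rational strictly between each coordinate of `x` and both competing
-- endpoints.
⋐-∩ : ∀ {n} (B C : Box n) x → x ∈ᵇ B → x ∈ᵇ C → ∃[ A ] (x ∈ᵇ A × A ⋐ B × A ⋐ C)
⋐-∩ B C x x∈B x∈C =
    (λ i → proj₁ (lo i) , proj₁ (hi i))
  , (λ i → proj₁ (proj₂ (lo i)) , proj₁ (proj₂ (hi i)))
  , (λ i → proj₁ (proj₂ (proj₂ (lo i))) , proj₁ (proj₂ (proj₂ (hi i))))
  , (λ i → proj₂ (proj₂ (proj₂ (lo i))) , proj₂ (proj₂ (proj₂ (hi i))))
  where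
  lo = λ i → lower-above-two (x i) (proj₁ (x∈B i)) (proj₁ (x∈C i))
  hi = λ i → upper-below-two (x i) (proj₂ (x∈B i)) (proj₂ (x∈C i))

⋐-shrink : ∀ {n} (B : Box n) x → x ∈ᵇ B → ∃[ A ] (x ∈ᵇ A × A ⋐ B)
⋐-shrink B x x∈B with A , x∈A , A⋐B , _ ← ⋐-∩ B B x x∈B x∈B = A , x∈A , A⋐B

-- Relatively open sets and discontinuity sets

IsOpenIn : ∀ {r} (E : Subset r) → Pred (∃ E) 0ℓ → Set₁
IsOpenIn E G = ∀ x → x ∈ G → ∃[ B ] (proj₁ x ∈ᵇ B × (∀ y → proj₁ y ∈ᵇ B → y ∈ G))

-- Continuity at a point passes from `L` to the smaller `K` with the same box.
D-mono : ∀ {r m} {E : Subset r} (f : ∃ E → ℝ^ m) {K L : Pred (∃ E) (lsuc 0ℓ)} →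
         K ⊆ L → D f K ⊆ D f L
D-mono f K⊆L (x∈K , ¬cont) = K⊆L x∈K , λ cont → ¬cont λ V fx∈V →
  let B , x∈B , B⊆ = cont V fx∈V in B , x∈B , λ y y∈K → B⊆ y (K⊆L y∈K)

module _ (em : ∀ ℓ → ExcludedMiddle ℓ) where

  -- Classical reasoning

  by-contradiction : ∀ {a} {P : Set a} → ¬ ¬ P → P
  by-contradiction = decidable-stable (em _)

  ¬∀⇒∃¬ : ∀ {a b} {A : Set a} {P : A → Set b} → ¬ (∀ x → P x) → ∃[ x ] ¬ P x
  ¬∀⇒∃¬ ¬∀ = by-contradiction λ ¬∃ → ¬∀ λ x → by-contradiction (curry ¬∃ x)

  -- Removed sets: as D f is monotone, x ∈ E_α iff x ∈ D f (E_β) for all β < α, whether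
  -- α is zero, a successor or a limit.

  module _ {r m} {E : Subset r} (f : ∃ E → ℝ^ m) (W : CountableWellOrder) where
    open CountableWellOrder W

    removedAcc-fold : ∀ {α} (a : Acc _≺_ α) {x} →
      (∀ {β} → β ≺ α → (b : Acc _≺_ β) → x ∈ D f (removedAcc f W β b)) →
      x ∈ removedAcc f W α a
    removedAcc-fold {α} (acc rs) h with em _ {IsZero α}
    ... | yes isZero = inj₁ isZero
    ... | no ¬isZero with em _ {∃[ β ] β ⋖ α}
    ... | yes (β , β⋖α) = inj₂ (inj₁ (β , β⋖α , h (proj₁ β⋖α) _))
    ... | no ¬succ = inj₂ (inj₂ ((¬isZero , curry ¬succ) , λ β β≺α → proj₁ (h β≺α _)))

    mutual
      -- The set `removedAcc` is built from an accessibility proof, so `b` has to be arbitrary. Two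
      -- proofs give the same set by folding what was unfolded, hence the mutual recursion.
      removedAcc-unfold : ∀ {α} (a : Acc _≺_ α) {x} → x ∈ removedAcc f W α a →
        ∀ {β} → β ≺ α → (b : Acc _≺_ β) → x ∈ D f (removedAcc f W β b)
      removedAcc-unfold (acc rs) (inj₁ isZero) β≺α b = contradiction β≺α (isZero _)
      removedAcc-unfold (acc rs) (inj₂ (inj₁ (γ , γ⋖α , x∈Dγ))) {β} β≺α b
        with IsStrictTotalOrder.compare isStrictTotalOrder β γ
      ... | tri< β≺γ _ _ = removedAcc-unfold (rs (proj₁ γ⋖α)) (proj₁ x∈Dγ) β≺γ b
      ... | tri≈ _ refl _ = D-mono f (removedAcc-irrelevant (rs (proj₁ γ⋖α)) b) x∈Dγ
      ... | tri> _ _ γ≺β = contradiction β≺α (proj₂ γ⋖α β γ≺β)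
      -- Membership at a limit only gives `x ∈ E_β`. As `α` is not the successor of `β`, some `γ`
      -- lies strictly between, and unfolding `x ∈ E_γ` at `β` gives the discontinuity.
      removedAcc-unfold (acc rs) (inj₂ (inj₂ ((_ , ¬succ) , x∈))) {β} β≺α b
        with γ , ¬¬between ← ¬∀⇒∃¬ (λ none → ¬succ β (β≺α , none))
        with β≺γ , γ≺α ← by-contradiction (λ ¬between → ¬¬between (curry ¬between)) =
        removedAcc-unfold (rs γ≺α) (x∈ γ γ≺α) β≺γ b

      removedAcc-irrelevant : ∀ {α} (a b : Acc _≺_ α) →
        removedAcc f W α a ⊆ removedAcc f W α b
      removedAcc-irrelevant a b x∈ = removedAcc-fold b (removedAcc-unfold a x∈)

    removed-unfold : ∀ {α β} → β ≺ α → removed f W α ⊆ D f (removed f W β)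
    removed-unfold {α} β≺α x∈ = removedAcc-unfold (wellFounded α) x∈ β≺α _

    removed-fold : ∀ {α x} → (∀ {β} → β ≺ α → x ∈ D f (removed f W β)) → x ∈ removed f W α
    removed-fold {α} h = removedAcc-fold (wellFounded α) λ β≺α b →
      D-mono f (removedAcc-irrelevant _ b) (h β≺α)

    -- A point outside `E_α` is outside `D f (E_β)` for some `β ≺ α`. This set is closed by
    -- induction and contains `E_α`, so a box avoiding it avoids `E_α`.
    removed-closed : (∀ K → IsClosed K → IsClosed (D f K)) → ∀ α → IsClosed (removed f W α)
    removed-closed closed-D α = go α (wellFounded α)
      where
      go : ∀ α → Acc _≺_ α → IsClosed (removed f W α)
      go α (acc rs) x x∉ =
        let β , ¬imp = ¬∀⇒∃¬ λ h → x∉ (removed-fold (λ {β} → h β))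
            β≺α , x∉D = by-contradiction {P = β ≺ α × x ∉ D f (removed f W β)}
              λ ¬both → ¬imp λ β≺α → by-contradiction λ x∉D → ¬both (β≺α , x∉D)
            B , x∈B , avoids = closed-D _ (go β (rs β≺α)) x x∉D
        in B , x∈B , λ y y∈B y∈ → avoids y y∈B (removed-unfold β≺α y∈)

  -- Comparison of removed sets along two well-orders

  module _ {r m} {E : Subset r} (f : ∃ E → ℝ^ m) (V W : CountableWellOrder) where
    private
      module V = CountableWellOrder V
      module W = CountableWellOrder W

    -- Induction on `α` with monotonicity of `D f`; elements of `W` outside the image only remove
    -- further points.
    removed-embed : (e : V.Carrier → W.Carrier) → (∀ {α β} → α V.≺ β → e α W.≺ e β) →
      ∀ α → removed f W (e α) ⊆ removed f V α
    removed-embed e mono α = go α (V.wellFounded α)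
      where
      go : ∀ α → Acc V._≺_ α → removed f W (e α) ⊆ removed f V α
      go α (acc rs) x∈ = removed-fold f V λ {β} β≺α →
        D-mono f (go β (rs β≺α)) (removed-unfold f W (mono β≺α) x∈)

  -- Baire category

  module _ {r} {E : Subset r} (compact : IsCompact E)
           {K : Pred (∃ E) (lsuc 0ℓ)} (K-closed : IsClosed K) (K≠∅ : Satisfiable K)
           {I : Set} (I↣ℕ : I ↣ ℕ)
           (G : I → Pred (∃ E) 0ℓ) (G-open : ∀ i → IsOpenIn E (G i)) where

    private
      code : I → ℕ
      code = Injection.to I↣ℕ

    Decides : Box r → I → Set₁
    Decides B i = (∀ y → y ∈ K → proj₁ y ∈ᵇ B → y ∈ G i) ⊎
                  (∀ y → y ∈ K → proj₁ y ∈ᵇ B → y ∉ G i)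

    Meets : Box r → Set₁
    Meets B = ∃[ x ] (x ∈ K × proj₁ x ∈ᵇ B)

    refine-deciding : ∀ i {B} → Meets B → ∃[ C ] (Meets C × C ⋐ B × Decides C i)
    refine-deciding i {B} (x , x∈K , x∈B) with em _ {∃[ y ] (y ∈ K × proj₁ y ∈ᵇ B × y ∈ G i)}
    ... | yes (y , y∈K , y∈B , y∈G) =
      let C , y∈C , C⊆G = G-open i y y∈G
          A , y∈A , A⋐B , A⋐C = ⋐-∩ B C (proj₁ y) y∈B y∈C
      in A , (y , y∈K , y∈A) , A⋐B , inj₁ λ z _ z∈A → C⊆G z (⋐⇒⊆ (proj₁ z) A⋐C z∈A)
    ... | no none =
      let A , x∈A , A⋐B = ⋐-shrink B (proj₁ x) x∈B
      in A , (x , x∈K , x∈A) , A⋐B ,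
         inj₂ λ z z∈K z∈A z∈G → none (z , z∈K , ⋐⇒⊆ (proj₁ z) A⋐B z∈A , z∈G)

    -- Stage `n` decides the index coded by `n`, unique by injectivity; if there is none, the box is
    -- merely shrunk.
    refine : ∀ n {B} → Meets B →
      ∃[ C ] (Meets C × C ⋐ B × (∀ i → code i ≡ n → Decides C i))
    refine n {B} (x , x∈K , x∈B) with em _ {∃[ i ] code i ≡ n}
    ... | yes (i , refl) =
      let C , meets , C⋐B , decides = refine-deciding i (x , x∈K , x∈B)
      in C , meets , C⋐B , λ j eq →
         subst (Decides C) (sym (Injection.injective I↣ℕ eq)) decides
    ... | no none =
      let A , x∈A , A⋐B = ⋐-shrink B (proj₁ x) x∈B
      in A , (x , x∈K , x∈A) , A⋐B , λ i eq → contradiction (i , eq) none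

    stage : ℕ → ∃ Meets
    stage zero = let x , x∈K = K≠∅ ; B , x∈B = box-around (proj₁ x) in B , x , x∈K , x∈B
    stage (suc n) = let C , meets , _ = refine n (proj₂ (stage n)) in C , meets

    stageBox : ℕ → Box r
    stageBox n = proj₁ (stage n)

    stageBox-⋐ : ∀ n → stageBox (suc n) ⋐ stageBox n
    stageBox-⋐ n = proj₁ (proj₂ (proj₂ (refine n (proj₂ (stage n)))))

    stageBox-decides : ∀ i → Decides (stageBox (suc (code i))) i
    stageBox-decides i =
      proj₂ (proj₂ (proj₂ (refine (code i) (proj₂ (stage (code i)))))) i refl

    stageBox-antitone : ∀ {k n} → k ℕ.≤′ n → ∀ y → y ∈ᵇ stageBox n → y ∈ᵇ stageBox k
    stageBox-antitone ℕ.≤′-refl           y y∈ = y∈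
    stageBox-antitone (ℕ.≤′-step {n} k≤n) y y∈ =
      stageBox-antitone k≤n y (⋐⇒⊆ y (stageBox-⋐ n) y∈)

    -- The complement of the closure of K ∩ stageBox n
    Avoiding : ℕ → Subset r
    Avoiding n x = ∃[ B ] (x ∈ᵇ B × (∀ y → y ∈ K → proj₁ y ∈ᵇ stageBox n → ¬ proj₁ y ∈ᵇ B))

    Adherent : ∃ E → Set₁
    Adherent x = ∀ n → ¬ Avoiding n (proj₁ x)

    -- Otherwise the open sets `Avoiding n` cover `E`. If `k` bounds the indices of a finite
    -- subcover, the point of `K` chosen in `stage k` lies in `stageBox n` for all `n ≤ k`, hence in
    -- no member of that subcover.
    adherent-exists : ∃ Adherent
    adherent-exists = by-contradiction λ none →
      let ns , covers = compact (Lift _ ℕ) (Avoiding ∘ Lift.lower)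
            (λ { _ x (B , x∈B , avoids) → B , x∈B , λ y y∈B → B , y∈B , avoids })
            (λ x x∈E → let n , ¬¬a = ¬∀⇒∃¬ (curry none (x , x∈E))
                       in lift n , by-contradiction ¬¬a)
          k = max 0 (map Lift.lower ns)
          _ , y , y∈K , y∈Bₖ = stage k
          n≤k , B , y∈B , avoids = All.lookupAny (xs≤max 0 (map Lift.lower ns))
                                     (Any.map⁺ (covers (proj₁ y) (proj₂ y)))
      in avoids y y∈K (stageBox-antitone (ℕ.≤⇒≤′ n≤k) (proj₁ y) y∈Bₖ) y∈B

    -- Adherence gives the closed box of stage `suc n`, which lies inside the open box of stage `n`.
    adherent-∈ᵇ : ∀ x → Adherent x → ∀ n → proj₁ x ∈ᵇ stageBox n
    adherent-∈ᵇ x adh n = ∉Exterior⇒∈ᵇ (proj₁ x) (stageBox-⋐ n) λ ext →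
      let C , x∈C , C⊆ext = Exterior-open (stageBox (suc n)) (proj₁ x) ext
      in adh (suc n) (C , x∈C , λ y _ y∈B y∈C →
           ∈ᵇ⇒∉Exterior (stageBox (suc n)) (proj₁ y) y∈B (C⊆ext (proj₁ y) y∈C))

    adherent-∈K : ∀ x → Adherent x → x ∈ K
    adherent-∈K x adh = by-contradiction λ x∉K →
      let B , x∈B , avoids = K-closed x x∉K
      in adh 0 (B , x∈B , λ y y∈K _ y∈B → avoids y y∈B y∈K)

    -- Some point of `K` avoids the relative boundaries of all `G i`: these are countably many
    -- nowhere dense sets.
    baire-category : ∃[ x ] (x ∈ K × (∀ i → x ∉ G i →
      ∃[ B ] (proj₁ x ∈ᵇ B × (∀ y → y ∈ K → proj₁ y ∈ᵇ B → y ∉ G i))))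
    baire-category =
      let x , adh = adherent-exists
          x∈K = adherent-∈K x adh
      in x , x∈K , λ i x∉G →
         stageBox (suc (code i)) , adherent-∈ᵇ x adh (suc (code i)) ,
         [ (λ all∈ → contradiction (all∈ x x∈K (adherent-∈ᵇ x adh (suc (code i)))) x∉G) , id ]′
           (stageBox-decides i)

  -- Continuity points of Baire one functions

  module _ {r m} {E : Subset r} (f : ∃ E → ℝ^ m) (baireOne : BaireOne f) where

    private
      fs : ℕ → ∃ E → ℝ^ m
      fs = proj₁ baireOne
      fs-continuous : ∀ n → Continuous (fs n)
      fs-continuous = proj₁ (proj₂ baireOne)
      fs→f : ConvergesPointwise fs f
      fs→f = proj₂ (proj₂ baireOne)

    -- The complement of the closed set on which fs n stays in the closure of V for all
    -- n ≥ N; on that set f is in the closure of V as well.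
    Escapes : RationalBox m × ℕ → Pred (∃ E) 0ℓ
    Escapes (V , N) x = ∃[ n ] (N ℕ.≤ n × Exterior (lookup V) (fs n x))

    Escapes-open : ∀ i → IsOpenIn E (Escapes i)
    Escapes-open (V , N) x (n , N≤n , ext) =
      let C , fx∈C , C⊆ext = Exterior-open (lookup V) (fs n x) ext
          B , x∈B , B→C = fs-continuous n x C fx∈C
      in B , x∈B , λ y y∈B → n , N≤n , C⊆ext (fs n y) (B→C y _ y∈B)

    -- The exterior is open, so if it contained `f y` it would contain `fs n y` for all large `n`,
    -- in particular for some `n ≥ N`.
    ∉Escapes⇒∉Exterior : ∀ {V N y} → y ∉ Escapes (V , N) → ¬ Exterior (lookup V) (f y)
    ∉Escapes⇒∉Exterior {V} {N} {y} y∉ ext =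
      let C , fy∈C , C⊆ext = Exterior-open (lookup V) (f y) ext
          M , eventually = fs→f y C fy∈C
          n = N ⊔ M
      in y∉ (n , ℕ.m≤m⊔n N M , C⊆ext (fs n y) (eventually n (ℕ.m≤n⊔m N M)))

    -- Let `x` be generic for the sets `Escapes`. For `V` around `f x`, shrink to `V′` and wait
    -- until `fs n x` stays in `V′`; then `x` does not escape, so nearby points of `K` do not
    -- either, and `f` maps them into the closed box of `V′`, inside `V`.
    baireOne-continuityPoint : IsCompact E → {K : Pred (∃ E) (lsuc 0ℓ)} →
      IsClosed K → Satisfiable K → ∃[ x ] (x ∈ K × ContinuousAt f K x)
    baireOne-continuityPoint compact {K} K-closed K≠∅ =
      let x , x∈K , generic = baire-category compact K-closed K≠∅
            (×-countable (RationalBox-countable m) ℕ-countable) Escapes Escapes-open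
      in x , x∈K , λ V fx∈V →
        let V′ , fx∈V′ , V′⋐V = ⋐-shrink V (f x) fx∈V
            -- The vector form of `V′` is what indexes the countable family.
            v = tabulate V′
            v⋐V = λ i → subst (λ c → proj₁ (V i) ℚ.< proj₁ c × proj₂ c ℚ.< proj₂ (V i))
                          (sym (lookup∘tabulate V′ i)) (V′⋐V i)
            N , eventually = fs→f x (lookup v) (∈ᵇ-tabulate V′ (f x) fx∈V′)
            B , x∈B , never = generic (v , N) λ { (n , N≤n , ext) →
              ∈ᵇ⇒∉Exterior (lookup v) (fs n x) (eventually n N≤n) ext }
        in B , x∈B , λ y y∈K y∈B →
          ∉Exterior⇒∈ᵇ (f y) v⋐V (∉Escapes⇒∉Exterior {v} {N} {y} (never y y∈K y∈B))

  -- Vanishing of the removed sets at a countable stage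

  module _ {r m} {E : Subset r} (f : ∃ E → ℝ^ m)
           (compact : IsCompact E) (solvable : Solvable f) where
    open Solvable solvable

    Misses : RationalBox r → CountableWellOrder → Set₁
    Misses b W = ∃[ α ] (∀ y → proj₁ y ∈ᵇ lookup b → y ∉ D f (removed f W α))

    private
      boxCode : RationalBox r → ℕ
      boxCode = Injection.to (RationalBox-countable r)

    Missed : ℕ → Set₁
    Missed n = ∃[ b ] (boxCode b ≡ n × ∃ (Misses b))

    -- Chooses one well-order per missed box, as a sequence along the codes; every other index
    -- receives `ℕ-wellOrder` as filler.
    orderMissing : ℕ → CountableWellOrder
    orderMissing n with em _ {Missed n}
    ... | yes (_ , _ , W , _) = W
    ... | no _                = ℕ-wellOrder

    -- The chosen order may differ from `W`, but the box it was chosen for has the code of `b` and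
    -- hence equals `b`.
    orderMissing-spec : ∀ {b W} → Misses b W → Misses b (orderMissing (boxCode b))
    orderMissing-spec {b} {W} missed with em _ {Missed (boxCode b)}
    ... | no none = contradiction (b , refl , W , missed) none
    ... | yes (b′ , eq , W′ , missed′) =
      subst (λ b → Misses b W′) (Injection.injective (RationalBox-countable r) eq) missed′

    open OrdinalSum orderMissing

    -- The choice ranges over all countable well-orders, `sum⁺` among them, so `b` already has a
    -- summand in which it is missed at some `α`. The copy of `α` lies below `⊤⁺`, and the removed
    -- set at `⊤⁺` is thus inside `D f (E_α)` of that summand.
    removed-sum⁺-misses : ∀ {b} → Misses b sum⁺ →
      ∀ y → proj₁ y ∈ᵇ lookup b → y ∉ removed f sum⁺ ⊤⁺
    removed-sum⁺-misses {b} missed y y∈b y∈S =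
      proj₂ spec y y∈b (D-mono f (embedded (proj₁ spec)) (removed-unfold f sum⁺ [ _ ]<⊤⁺ y∈S))
      where
      n = boxCode b
      spec : Misses b (orderMissing n)
      spec = orderMissing-spec missed
      embedded : ∀ α → removed f sum⁺ [ n , α ] ⊆ removed f (orderMissing n) α
      embedded = removed-embed f (orderMissing n) sum⁺ (λ a → [ n , a ]) (λ p → [ right p ])

    removed-sum⁺-closed : IsClosed (removed f sum⁺ ⊤⁺)
    removed-sum⁺-closed = removed-closed f sum⁺ closed-D ⊤⁺

    removed-sum⁺-discontinuous : ∀ x → x ∈ removed f sum⁺ ⊤⁺ →
      ¬ ContinuousAt f (removed f sum⁺ ⊤⁺) x
    removed-sum⁺-discontinuous x x∈S cont =
      let B , x∈B , avoids = closed-D _ removed-sum⁺-closed x (λ x∈D → proj₂ x∈D cont)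
      -- The box is missed at `⊤⁺` itself, which makes it disjoint from the whole removed set there
      -- and not just from its discontinuity points.
      in removed-sum⁺-misses {tabulate B} (⊤⁺ , λ y y∈b → avoids y (∈ᵇ-tabulate⁻ B (proj₁ y) y∈b))
           x (∈ᵇ-tabulate B (proj₁ x) x∈B) x∈S

    removed-sum⁺-empty : Empty (removed f sum⁺ ⊤⁺)
    removed-sum⁺-empty x₀ x₀∈S =
      let x , x∈S , cont =
            baireOne-continuityPoint f baireOne compact removed-sum⁺-closed (x₀ , x₀∈S)
      in removed-sum⁺-discontinuous x x∈S cont

mainTheorem6 : (∀ ℓ → ExcludedMiddle ℓ) →
    (r m : ℕ) (E : Subset r) → IsCompactDomain E →
    (f : ∃ E → ℝ^ m) → Solvable f →
    ∃[ W ] ∃[ α ] Empty (removed f W α)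
mainTheorem6 em r m E domain f solvable =
  sum⁺ , ⊤⁺ , removed-sum⁺-empty em f compact solvable
  where
  open IsCompactDomain domain using (compact)
  open OrdinalSum (orderMissing em f compact solvable)
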